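{- Call a positive integer $d$ admissible if either $d=1$, or $d$ can be written as $d=f\cdot\prod_{i=1}^{m}p_i^{2k_i}$ with $m\ge 1$, distinct primes $p_1<p_2<\dots<p_m$, integers $k_i\ge 0$, where $f=2$ if $p_1=2$ and $f=1$ if $p_1>2$, and where every $p_i$ divides $d$ (i.e. $k_i\ge 1$ for every $p_i>2$). For $d=1$ put $f=1$ and $s=1$; otherwise put $s=\prod_{i=1}^m p_i^{k_i}$ (so $d=f s^2$). Let $d$ be admissible and let $r$ be a positive integer such that (1) $r\ge \lceil \sqrt{f\,d/2}\,\rceil$, and (2) if $d>1$, then no prime divisor of $d$ divides $r$. Put $n=s\cdot r$ and $$a=2n+d=2sr+f s^2,\qquad b=2n+\frac{2n^2}{d}=2sr+\frac{2r^2}{f},\qquad c=b+d=2sr+\frac{2r^2}{f}+f s^2.$$ Then $(a,b,c)$ is an IDPT. Conversely, every IDPT $(a,b,c)$ arises in this way from some admissible $d$ and some positive integer $r$ satisfying (1) and (2) (namely with $d=c-b$).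
   Context: A Diophantine Pythagorean Triangle (DPT) is a triple $(a,b,c)$ of positive integers with $a<b<c$ and $a^2+b^2=c^2$. An Irreducible Diophantine Pythagorean Triangle (IDPT) is a DPT with $\gcd(a,b,c)=1$. $\lceil x\rceil$ denotes the smallest integer $\ge x$. -}

module Defs where

open import Data.Fin as Fin using (zero; suc)
open import Data.Integer as ℤ using (+_; -[1+_])
import Data.Integer.Properties as ℤ
open import Data.Nat
open import Data.Nat.Divisibility using (_∣_)
open import Data.Nat.DivMod using (_/_)
open import Data.Nat.GCD using (gcd)
open import Data.Nat.Primality using (Prime; prime⇒nonZero)
open import Data.Nat.Properties
open import Data.Rational.Unnormalised as ℚᵘ using (ℚᵘ; mkℚᵘ; *≤*)
import Data.Rational.Unnormalised.Properties as ℚᵘ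
open import Data.Vec.Functional using (Vector; foldr)
open import Relation.Binary.PropositionalEquality
open import Relation.Nullary using (¬_; yes; no)

record DPT (a b c : ℕ) : Set where
  field
    a-positive  : 0 < a
    b-positive  : 0 < b
    c-positive  : 0 < c
    a<b         : a < b
    b<c         : b < c
    pythagorean : a ^ 2 + b ^ 2 ≡ c ^ 2

record IDPT (a b c : ℕ) : Set where
  field
    dpt         : DPT a b c
    irreducible : gcd (gcd a b) c ≡ 1

infix 4 √_≤_

-- For k : ℕ, the inequality √q ≤ k means q ≤ k².
√_≤_ : ℚᵘ → ℕ → Set
√ q ≤ k = q ℚᵘ.≤ (+ (k * k)) ℚᵘ./ 1

-- The first j ≥ k with √q ≤ j, trying at most `fuel` candidates before
-- returning k + fuel.
searchCeil√ : ℚᵘ → (fuel k : ℕ) → ℕ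
searchCeil√ q zero       k = k
searchCeil√ q (suc fuel) k with q ℚᵘ.≤? (+ (k * k)) ℚᵘ./ 1
... | yes _ = k
... | no  _ = searchCeil√ q fuel (suc k)

-- The ceiling of √q for q ≥ 0.  As √q ≥ 0, it is the least natural number k
-- with √q ≤ k (ceil√-upper and ceil√-least); the numerator of q bounds the
-- search.
⌈√_⌉ : ℚᵘ → ℕ
⌈√ q ⌉ = searchCeil√ q ℤ.∣ ℚᵘ.↥ q ∣ 0

private
  search-upper : ∀ q fuel k → √ q ≤ k + fuel → √ q ≤ searchCeil√ q fuel k
  search-upper q zero       k h = subst (√ q ≤_) (+-identityʳ k) h
  search-upper q (suc fuel) k h with q ℚᵘ.≤? (+ (k * k)) ℚᵘ./ 1
  ... | yes √q≤k = √q≤k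
  ... | no  _    = search-upper q fuel (suc k) (subst (√ q ≤_) (+-suc k fuel) h)

  search-least : ∀ q fuel k j → k ≤ j → √ q ≤ j → searchCeil√ q fuel k ≤ j
  search-least q zero       k j k≤j h = k≤j
  search-least q (suc fuel) k j k≤j h with q ℚᵘ.≤? (+ (k * k)) ℚᵘ./ 1
  ... | yes _    = k≤j
  ... | no  √q≰k = search-least q fuel (suc k) j
                     (≤∧≢⇒< k≤j (λ { refl → √q≰k h })) h

  n≤n*n*m : ∀ n m → n ≤ n * n * suc m
  n≤n*n*m zero    m = z≤n
  n≤n*n*m (suc n) m = ≤-trans (m≤m*n (suc n) (suc n)) (m≤m*n (suc n * suc n) (suc m))

  √≤numerator : ∀ q → √ q ≤ ℤ.∣ ℚᵘ.↥ q ∣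
  √≤numerator (mkℚᵘ (+ n) m) = *≤* (subst₂ ℤ._≤_
    (sym (ℤ.*-identityʳ (+ n))) (ℤ.pos-* (n * n) (suc m)) (ℤ.+≤+ (n≤n*n*m n m)))
  √≤numerator (mkℚᵘ -[1+ n ] m) = *≤* (subst₂ ℤ._≤_
    (sym (ℤ.*-identityʳ -[1+ n ])) (ℤ.pos-* (suc n * suc n) (suc m)) ℤ.-≤+)

ceil√-upper : ∀ q → √ q ≤ ⌈√ q ⌉
ceil√-upper q = search-upper q ℤ.∣ ℚᵘ.↥ q ∣ 0 (√≤numerator q)

ceil√-least : ∀ q j → √ q ≤ j → ⌈√ q ⌉ ≤ j
ceil√-least q j = search-least q ℤ.∣ ℚᵘ.↥ q ∣ 0 j z≤n

∏ : ∀ {m} → Vector ℕ m → ℕ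
∏ = foldr _*_ 1

-- The value of f determined by the least prime p₁.
coefficient : ℕ → ℕ
coefficient 2 = 2
coefficient _ = 1

-- There are m = suc m-1 ≥ 1 primes, indexed from zero, so p₁ is p zero.
record PrimePowerForm (d : ℕ) : Set where
  field
    {m-1}      : ℕ
    p          : Vector ℕ (suc m-1)
    k          : Vector ℕ (suc m-1)
    p-prime    : ∀ i → Prime (p i)
    increasing : ∀ i j → i Fin.< j → p i < p j
    p∣d        : ∀ i → p i ∣ d
    d≡f∏       : d ≡ coefficient (p zero) * ∏ (λ i → p i ^ (2 * k i))

data Admissible (d : ℕ) : Set where
  isOne   : d ≡ 1 → Admissible d
  hasForm : PrimePowerForm d → Admissible d

f : ∀ {d} → Admissible d → ℕ
f (isOne _)   = 1
f (hasForm F) = coefficient (PrimePowerForm.p F zero)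

s : ∀ {d} → Admissible d → ℕ
s (isOne _)   = 1
s (hasForm F) = ∏ (λ i → p i ^ k i)
  where open PrimePowerForm F

private
  coefficient-nonZero : ∀ p₁ → NonZero (coefficient p₁)
  coefficient-nonZero 0                   = _
  coefficient-nonZero 1                   = _
  coefficient-nonZero 2                   = _
  coefficient-nonZero (suc (suc (suc _))) = _

  ∏-nonZero : ∀ {m} (v : Vector ℕ m) → (∀ i → NonZero (v i)) → NonZero (∏ v)
  ∏-nonZero {zero}  v h = _
  ∏-nonZero {suc m} v h =
    m*n≢0 (v zero) _ {{h zero}} {{∏-nonZero (λ i → v (suc i)) (λ i → h (suc i))}}

f-nonZero : ∀ {d} (A : Admissible d) → NonZero (f A)
f-nonZero (isOne _)   = _
f-nonZero (hasForm F) = coefficient-nonZero (PrimePowerForm.p F zero)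

admissible⇒nonZero : ∀ {d} → Admissible d → NonZero d
admissible⇒nonZero (isOne refl) = _
admissible⇒nonZero (hasForm F)  = subst NonZero (sym d≡f∏)
  (m*n≢0 _ _ {{coefficient-nonZero (p zero)}}
    {{∏-nonZero _ (λ i → m^n≢0 (p i) (2 * k i) {{prime⇒nonZero (p-prime i)}})}})
  where open PrimePowerForm F

record Conditions {d : ℕ} (A : Admissible d) (r : ℕ) : Set where
  field
    r-positive      : 0 < r
    bound           : ⌈√ (+ (f A * d)) ℚᵘ./ 2 ⌉ ≤ r
    no-common-prime : 1 < d → ∀ q → Prime q → q ∣ d → ¬ (q ∣ r)

module Triple {d : ℕ} (A : Admissible d) (r : ℕ) where

  private instance
    d≢0 : NonZero d
    d≢0 = admissible⇒nonZero A

    f≢0 : NonZero (f A)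
    f≢0 = f-nonZero A

  n a b c : ℕ
  n = s A * r
  a = 2 * n + d
  b = 2 * n + (2 * n ^ 2) / d
  c = b + d

  -- Since _/_ truncates on ℕ, the divisibilities are needed to make the
  -- quotients 2n²/d and 2r²/f the true ones.
  record ClosedForms : Set where
    field
      d≡fs²  : d ≡ f A * s A ^ 2
      d∣2n²  : d ∣ 2 * n ^ 2
      f∣2r²  : f A ∣ 2 * r ^ 2
      a-form : a ≡ 2 * s A * r + f A * s A ^ 2
      b-form : b ≡ 2 * s A * r + (2 * r ^ 2) / f A
      c-form : c ≡ 2 * s A * r + (2 * r ^ 2) / f A + f A * s A ^ 2

{-# OPTIONS --safe #-}

-- Prime factorisation shows that the admissible d are the numbers f s² with
-- either f = 1 and s odd, or f = 2 and s arbitrary.  For such d, put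
-- q = 2r²/f; then a² = (c − b)(c + b) is an identity, a < b says f d < 2r²
-- (equality in the bound (1) is excluded by (2)), and a prime dividing
-- a, b and c divides d and q, hence r.
--
-- Conversely, if d = c − b is odd then d and c + b are coprime with product a²,
-- so d = s² and c + b = (s + 2r)²; if d is even then d/2 and (c + b)/2 are
-- coprime with product (a/2)², so d = 2s² and c + b = 2(s + r)².
module Submission where

open import Defs
open import Data.Fin as Fin using (Fin; zero; suc)
import Data.Integer as ℤ
import Data.Integer.Properties as ℤ
open import Data.List.Base using ([]; _∷_)
open import Data.List.Relation.Unary.All using ([]; _∷_)
open import Data.Nat
open import Data.Nat.Coprimality using (Coprime; coprime-divisor)
open import Data.Nat.Divisibility
open import Data.Nat.DivMod using (_/_; m*n/n≡m; m*[n/m]≡n)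
open import Data.Nat.GCD using (gcd; gcd[m,n]∣m; gcd[m,n]∣n; gcd[m,n]≢0; gcd-greatest)
open import Data.Nat.Induction using (<-rec)
open import Data.Nat.ListAction using (product)
open import Data.Nat.Primality
open import Data.Nat.Primality.Factorisation using (factorise)
open import Data.Nat.Properties
open import Data.Nat.Tactic.RingSolver using (solve-∀)
open import Data.Product using (_×_; Σ-syntax; ∃-syntax; _,_)
open import Data.Rational.Unnormalised as ℚᵘ using (*≤*)
open import Data.Sum using (inj₁; inj₂; [_,_]′)
open import Data.Vec.Functional as Vector using (Vector)
open import Function using (_∘_; id; case_of_)
open import Relation.Binary.PropositionalEquality
open import Relation.Nullary using (¬_; yes; no; contradiction)

private
  variable
    m n : ℕ

-- Prime divisors, coprimality and squares.

prime-divisor : .{{NonTrivial n}} → ∃[ p ] Prime p × p ∣ n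
prime-divisor {n@(2+ _)} with factorise n
... | record { factors = [] ; isFactorisation = () }
... | record { factors = p ∷ ps ; isFactorisation = n≡ ; factorsPrime = p-prime ∷ _ } =
  p , p-prime , subst (p ∣_) (sym n≡) (m∣m*n (product ps))

no-prime-divisor⇒≡1 : (∀ p → Prime p → ¬ p ∣ n) → n ≡ 1
no-prime-divisor⇒≡1 {0}    h = contradiction (2 ∣0) (h 2 prime[2])
no-prime-divisor⇒≡1 {1}    h = refl
no-prime-divisor⇒≡1 {2+ n} h with p , p-prime , p∣n ← prime-divisor {2+ n} =
  contradiction p∣n (h p p-prime)

no-common-prime⇒coprime : (∀ p → Prime p → p ∣ m → ¬ p ∣ n) → Coprime m n
no-common-prime⇒coprime h (d∣m , d∣n) = no-prime-divisor⇒≡1 λ p p-prime p∣d →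
  h p p-prime (∣-trans p∣d d∣m) (∣-trans p∣d d∣n)

prime∣^⇒prime∣ : ∀ {p} → Prime p → ∀ k → p ∣ n ^ k → p ∣ n
prime∣^⇒prime∣     p-prime zero    p∣1 =
  contradiction (subst Prime (∣1⇒≡1 p∣1) p-prime) ¬prime[1]
prime∣^⇒prime∣ {n} p-prime (suc k) p∣nⁿ =
  [ id , prime∣^⇒prime∣ p-prime k ]′ (euclidsLemma n (n ^ k) p-prime p∣nⁿ)

prime∣prime⇒≡ : ∀ {p q} → Prime p → Prime q → p ∣ q → p ≡ q
prime∣prime⇒≡ p-prime q-prime p∣q with prime⇒irreducible q-prime p∣q
... | inj₁ p≡1 = contradiction (subst Prime p≡1 p-prime) ¬prime[1]
... | inj₂ p≡q = p≡q

-- With g = gcd m r and r = g t, both m ∣ g² and g² ∣ m follow from coprimality.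
coprime-square : ∀ {r} → .{{NonZero m}} → Coprime m n → m * n ≡ r ^ 2 →
                 ∃[ g ] ∃[ t ] m ≡ g ^ 2 × n ≡ t ^ 2 × r ≡ g * t
coprime-square {m} {n} {r} m⊥n mn≡r² = g , t , m≡g² , n≡t² , r≡gt
  where
  g = gcd m r
  instance
    g≢0 : NonZero g
    g≢0 = ≢-nonZero (gcd[m,n]≢0 m r (inj₁ (≢-nonZero⁻¹ m)))
  g∣m = gcd[m,n]∣m m r
  g∣r = gcd[m,n]∣n m r
  u = quotient g∣m
  t = quotient g∣r
  m≡gu : m ≡ g * u
  m≡gu = m∣n⇒n≡m*quotient g∣m
  r≡gt : r ≡ g * t
  r≡gt = m∣n⇒n≡m*quotient g∣r
  un≡gt² : u * n ≡ g * t ^ 2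
  un≡gt² = *-cancelˡ-≡ _ _ g (begin
    g * (u * n)     ≡⟨ *-assoc g u n ⟨
    g * u * n       ≡⟨ cong (_* n) m≡gu ⟨
    m * n           ≡⟨ mn≡r² ⟩
    r ^ 2           ≡⟨ cong (_^ 2) r≡gt ⟩
    (g * t) ^ 2     ≡⟨ lemma g t ⟩
    g * (g * t ^ 2) ∎)
    where
    open ≡-Reasoning
    -- The ring solver does not read _^_, so its squares are unfolded, here and below.
    lemma : ∀ g t → (g * t) * (g * t * 1) ≡ g * (g * (t * (t * 1)))
    lemma = solve-∀
  u⊥t : Coprime u t
  -- A common divisor `d` of `u` and `t` makes `g * d` a common divisor of `m` and `r`, hence a
  -- divisor of their gcd `g`.
  u⊥t {d} (d∣u , d∣t) = ∣1⇒≡1 (*-cancelˡ-∣ g (subst (g * d ∣_) (sym (*-identityʳ g))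
    (gcd-greatest (subst (g * d ∣_) (sym m≡gu) (*-monoʳ-∣ g d∣u))
                  (subst (g * d ∣_) (sym r≡gt) (*-monoʳ-∣ g d∣t)))))
  u∣g : u ∣ g
  u∣g = coprime-divisor u⊥t (coprime-divisor u⊥t (subst (u ∣_)
    (trans un≡gt² (lemma g t)) (m∣m*n n)))
    where
    lemma : ∀ g t → g * (t * (t * 1)) ≡ t * (t * g)
    lemma = solve-∀
  g∣u : g ∣ u
  g∣u = coprime-divisor (λ (d∣g , d∣n) → m⊥n (∣-trans d∣g g∣m , d∣n))
    (subst (g ∣_) (trans (sym un≡gt²) (*-comm u n)) (m∣m*n (t ^ 2)))
  u≡g : u ≡ g
  u≡g = ∣-antisym u∣g g∣u
  m≡g² : m ≡ g ^ 2
  m≡g² = trans m≡gu (cong (g *_) (trans u≡g (sym (*-identityʳ g))))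
  n≡t² : n ≡ t ^ 2
  n≡t² = *-cancelˡ-≡ _ _ g (subst (λ v → v * n ≡ g * t ^ 2) u≡g un≡gt²)

-- Admissibility without lists of primes.

-- The condition on the least prime reduces to the parity of `s`, so everything outside the
-- factorisation argument works with this. Since `double-square` allows `s = 0`, nonzeroness is
-- carried separately.
data Shape : (f s : ℕ) → Set where
  odd-square    : ∀ {s} → ¬ 2 ∣ s → Shape 1 s
  double-square : ∀ {s} → Shape 2 s

shape-∣2 : ∀ {f s} → Shape f s → f ∣ 2
shape-∣2 (odd-square _) = 1∣ 2
shape-∣2 double-square  = ∣-refl

square-∏ : (p k : Vector ℕ m) → ∏ (λ i → p i ^ (2 * k i)) ≡ ∏ (λ i → p i ^ k i) ^ 2
square-∏ {zero}  p k = refl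
square-∏ {suc m} p k = begin
  p zero ^ (2 * k zero) * _
    ≡⟨ cong₂ _*_
         (trans (cong (p zero ^_) (*-comm 2 (k zero))) (sym (^-*-assoc (p zero) (k zero) 2)))
         (square-∏ (p ∘ suc) (k ∘ suc)) ⟩
  (p zero ^ k zero) ^ 2 * ∏ (λ i → p (suc i) ^ k (suc i)) ^ 2
    ≡⟨ lemma (p zero ^ k zero) _ ⟩
  (p zero ^ k zero * ∏ (λ i → p (suc i) ^ k (suc i))) ^ 2 ∎
  where
  open ≡-Reasoning
  lemma : ∀ x y → (x * (x * 1)) * (y * (y * 1)) ≡ x * y * (x * y * 1)
  lemma = solve-∀

∣-∏ : (v : Vector ℕ m) (i : Fin m) → v i ∣ ∏ v
∣-∏ v zero    = m∣m*n _
∣-∏ v (suc i) = ∣n⇒∣m*n (v zero) (∣-∏ (v ∘ suc) i)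

prime∣∏ : ∀ {p} → Prime p → (v : Vector ℕ m) → p ∣ ∏ v → ∃[ i ] p ∣ v i
prime∣∏ {m = zero}  p-prime v p∣1 = contradiction (subst Prime (∣1⇒≡1 p∣1) p-prime) ¬prime[1]
prime∣∏ {m = suc m} p-prime v p∣∏ with euclidsLemma (v zero) _ p-prime p∣∏
... | inj₁ p∣v₀  = zero , p∣v₀
... | inj₂ p∣∏v′ with i , p∣vᵢ ← prime∣∏ p-prime (v ∘ suc) p∣∏v′ = suc i , p∣vᵢ

coefficient-≢2 : ∀ n → n ≢ 2 → coefficient n ≡ 1
coefficient-≢2 0                   n≢2 = refl
coefficient-≢2 1                   n≢2 = refl
coefficient-≢2 2                   n≢2 = contradiction refl n≢2
coefficient-≢2 (suc (suc (suc _))) n≢2 = refl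

prime⇒≥2 : ∀ {p} → Prime p → 2 ≤ p
prime⇒≥2 {p} p-prime = nonTrivial⇒n>1 p {{prime⇒nonTrivial p-prime}}

-- If 2 divides `s`, then 2 is one of the `p i`; as `p zero` is the least of them and at least 2, it
-- equals 2.
admissible-shape : ∀ {d} (A : Admissible d) → Shape (f A) (s A)
admissible-shape (isOne _)   = odd-square λ 2∣1 → contradiction (∣1⇒≡1 2∣1) λ ()
admissible-shape (hasForm F) = by-least-prime (p zero ≟ 2)
  where
  open PrimePowerForm F
  least : ∀ i → p zero ≤ p i
  least zero    = ≤-refl
  least (suc i) = <⇒≤ (increasing zero (suc i) z<s)
  by-least-prime : _ → Shape (coefficient (p zero)) (∏ (λ i → p i ^ k i))
  by-least-prime (yes p₀≡2) rewrite p₀≡2 = double-square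
  by-least-prime (no  p₀≢2) rewrite coefficient-≢2 (p zero) p₀≢2 = odd-square λ 2∣s →
    let i , 2∣pᵏ = prime∣∏ prime[2] (λ i → p i ^ k i) 2∣s
        2≡pᵢ     = prime∣prime⇒≡ prime[2] (p-prime i) (prime∣^⇒prime∣ prime[2] (k i) 2∣pᵏ)
    in p₀≢2 (≤-antisym (subst (p zero ≤_) (sym 2≡pᵢ) (least i)) (prime⇒≥2 (p-prime zero)))

admissible-≡fs² : ∀ {d} (A : Admissible d) → d ≡ f A * s A ^ 2
admissible-≡fs² (isOne d≡1) = d≡1
admissible-≡fs² (hasForm F) = trans d≡f∏ (cong (coefficient (p zero) *_) (square-∏ p k))
  where open PrimePowerForm F

-- Factorisation into powers of increasing primes.

split-power : ∀ p n → .{{NonTrivial p}} → .{{NonZero n}} →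
              ∃[ k ] ∃[ t ] n ≡ p ^ k * t × ¬ p ∣ t
split-power p n = <-rec P step n
  where
  P : ℕ → Set
  P n = .{{NonTrivial p}} → .{{NonZero n}} → ∃[ k ] ∃[ t ] n ≡ p ^ k * t × ¬ p ∣ t
  step : ∀ n → (∀ {m} → m < n → P m) → P n
  step n rec {{p>1}} with p ∣? n
  ... | no  p∤n = 0 , n , sym (*-identityˡ n) , p∤n
  ... | yes p∣n
    with k , t , q≡ , p∤t ← rec (quotient-< p∣n) {{p>1}} {{quotient≢0 p∣n}} =
    suc k , t , trans (m∣n⇒n≡m*quotient p∣n)
      (trans (cong (p *_) q≡) (sym (*-assoc p (p ^ k) t))) , p∤t

-- The lower bound `m≤p` lets a smaller prime be prepended while keeping the list increasing, and
-- for `m = 3` it forces coefficient 1. Positive exponents make every `p i` divide `n`.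
record PrimePowers (m n : ℕ) : Set where
  field
    {len}      : ℕ
    p k        : Vector ℕ len
    p-prime    : ∀ i → Prime (p i)
    increasing : ∀ i j → i Fin.< j → p i < p j
    m≤p        : ∀ i → m ≤ p i
    k-positive : ∀ i → 0 < k i
    n≡∏        : n ≡ ∏ (λ i → p i ^ k i)

∷-increasing : (v : Vector ℕ n) → (∀ i → m < v i) → (∀ i j → i Fin.< j → v i < v j) →
               ∀ i j → i Fin.< j → (m Vector.∷ v) i < (m Vector.∷ v) j
∷-increasing v m<v v-inc zero    (suc j) _         = m<v j
∷-increasing v m<v v-inc (suc i) (suc j) (s<s i<j) = v-inc i j i<j

-- Trial division by `m`, `m + 1`, and so on. Roughness says that `n` has no divisor from 2 to
-- `m - 1`, so `m` is prime whenever it divides `n`, and the cofactor left after removing all powers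
-- of `m` is rough for `suc m`. The sum `m + fuel` stays constant; when the fuel is gone `n < m`,
-- which a rough `n > 1` excludes because it divides itself.
primePowers : ∀ fuel m n → .{{NonTrivial m}} → .{{NonZero n}} →
              n < m + fuel → m Rough n → PrimePowers m n
primePowers fuel       m 1 _    _   = record
  { len = 0 ; p = λ () ; k = λ () ; p-prime = λ () ; increasing = λ () ; m≤p = λ ()
  ; k-positive = λ () ; n≡∏ = refl }
primePowers zero       m n@(2+ _) n<m+0 rgh =
  contradiction (subst (n <_) (+-identityʳ m) n<m+0) (≤⇒≯ (rough⇒≤ rgh))
primePowers (suc fuel) m n@(2+ _) n<m+1+fuel rgh with split-power m n
... | zero , t , n≡ , m∤t = record
  { PrimePowers rest ; m≤p = <⇒≤ ∘ PrimePowers.m≤p rest }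
  where
  n≡t = trans n≡ (*-identityˡ t)
  rest = primePowers fuel (suc m) n {{n>1⇒nonTrivial (m<n⇒m<1+n (nonTrivial⇒n>1 m))}}
    (subst (n <_) (+-suc m fuel) n<m+1+fuel)
    (∤⇒rough-suc (subst (¬_ ∘ (m ∣_)) (sym n≡t) m∤t) rgh)
... | suc k₀ , t , n≡ , m∤t = record
  { p          = m Vector.∷ R.p
  ; k          = suc k₀ Vector.∷ R.k
  ; p-prime    = λ { zero → rough∧∣⇒prime rgh m∣n ; (suc i) → R.p-prime i }
  ; increasing = ∷-increasing R.p R.m≤p R.increasing
  ; m≤p        = λ { zero → ≤-refl ; (suc i) → <⇒≤ (R.m≤p i) }
  ; k-positive = λ { zero → z<s ; (suc i) → R.k-positive i }
  ; n≡∏        = trans n≡ (cong (m ^ suc k₀ *_) R.n≡∏)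
  }
  where
  m∣n : m ∣ n
  m∣n = subst (m ∣_) (sym n≡) (∣m⇒∣m*n t (m∣m*n (m ^ k₀)))
  t∣n : t ∣ n
  t∣n = subst (t ∣_) (sym n≡) (n∣m*n (m ^ suc k₀))
  rest : PrimePowers (suc m) t
  rest = primePowers fuel (suc m) t {{n>1⇒nonTrivial (m<n⇒m<1+n (nonTrivial⇒n>1 m))}}
    {{≢-nonZero λ { refl → m∤t (m ∣0) }}}
    (≤-<-trans (∣⇒≤ t∣n) (subst (n <_) (+-suc m fuel) n<m+1+fuel))
    (∤⇒rough-suc m∤t (rough∧∣⇒rough rgh t∣n))
  module R = PrimePowers rest

odd-primePowers : .{{NonZero n}} → ¬ 2 ∣ n → PrimePowers 3 n
odd-primePowers {n} 2∤n = primePowers n 3 n (m<n+m n z<s) (∤⇒rough-suc 2∤n 2-rough)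

coefficient-≥3 : 3 ≤ n → coefficient n ≡ 1
coefficient-≥3 {n} 3≤n = coefficient-≢2 n λ { refl → contradiction 3≤n λ { (s≤s (s≤s ())) } }

p∣n : (P : PrimePowers m n) → ∀ i → PrimePowers.p P i ∣ n
p∣n P i = subst (p i ∣_) (sym n≡∏)
  (∣-trans (base∣power (k i) (k-positive i)) (∣-∏ (λ i → p i ^ k i) i))
  where
  open PrimePowers P
  base∣power : ∀ k → 0 < k → p i ∣ p i ^ k
  base∣power (suc k) _ = m∣m*n (p i ^ k)

shape-admissible : ∀ {g u} → .{{NonZero u}} → Shape g u →
                   Σ[ A ∈ Admissible (g * u ^ 2) ] f A ≡ g × s A ≡ u
shape-admissible {u = u} (odd-square 2∤u) with odd-primePowers 2∤u
-- An empty product means `u = 1`, and this is the case `d = 1`.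
... | record { len = zero ; n≡∏ = refl } = isOne refl , refl , refl
... | P@record { len = suc l } = hasForm form , f≡1 , sym n≡∏
  where
  open PrimePowers P
  f≡1 = coefficient-≥3 (m≤p zero)
  form : PrimePowerForm (1 * u ^ 2)
  form = record
    { p          = p
    ; k          = k
    ; p-prime    = p-prime
    ; increasing = increasing
    ; p∣d        = λ i → ∣n⇒∣m*n 1 (∣m⇒∣m*n (u * 1) (p∣n P i))
    ; d≡f∏       = cong₂ _*_ (sym f≡1) (trans (cong (_^ 2) n≡∏) (sym (square-∏ p k)))
    }
shape-admissible {u = u} double-square
  with k₀ , t , u≡ , 2∤t ← split-power 2 u = hasForm form , refl , sym u≡∏
  where
  instance
    t≢0 : NonZero t
    t≢0 = ≢-nonZero λ { refl → 2∤t (2 ∣0) }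
  P = odd-primePowers 2∤t
  open PrimePowers P
  p′ = 2 Vector.∷ p
  k′ = k₀ Vector.∷ k
  u≡∏ : u ≡ ∏ (λ i → p′ i ^ k′ i)
  u≡∏ = trans u≡ (cong (2 ^ k₀ *_) n≡∏)
  form : PrimePowerForm (2 * u ^ 2)
  form = record
    { p          = p′
    ; k          = k′
    ; p-prime    = λ { zero → prime[2] ; (suc i) → p-prime i }
    ; increasing = ∷-increasing p m≤p increasing
    -- The coefficient supplies this factor 2, so `k₀` may be zero.
    ; p∣d        = λ { zero    → m∣m*n (u ^ 2)
                     ; (suc i) → ∣n⇒∣m*n 2 (∣m⇒∣m*n (u * 1)
                         (∣-trans (p∣n P i) (subst (t ∣_) (sym u≡) (n∣m*n (2 ^ k₀))))) }
    ; d≡f∏       = cong (2 *_) (trans (cong (_^ 2) u≡∏) (sym (square-∏ p′ k′)))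
    }

-- The ceiling bound and the closed forms.

ceil√-half-≤⇒ : ∀ x r → ⌈√ (ℤ.+ x) ℚᵘ./ 2 ⌉ ≤ r → x ≤ 2 * r ^ 2
ceil√-half-≤⇒ x r j≤r with *≤* x≤2j² ← ceil√-upper ((ℤ.+ x) ℚᵘ./ 2) = begin
  x           ≡⟨ *-identityʳ x ⟨
  x * 1       ≤⟨ ℤ.drop‿+≤+ (subst₂ ℤ._≤_ (sym (ℤ.pos-* x 1)) (sym (ℤ.pos-* (j * j) 2)) x≤2j²) ⟩
  j * j * 2   ≤⟨ *-monoˡ-≤ 2 (*-mono-≤ j≤r j≤r) ⟩
  r * r * 2   ≡⟨ lemma r ⟩
  2 * r ^ 2   ∎
  where
  open ≤-Reasoning
  j = ⌈√ (ℤ.+ x) ℚᵘ./ 2 ⌉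
  lemma : ∀ r → r * r * 2 ≡ 2 * (r * (r * 1))
  lemma = solve-∀

≤⇒ceil√-half-≤ : ∀ x r → x ≤ 2 * r ^ 2 → ⌈√ (ℤ.+ x) ℚᵘ./ 2 ⌉ ≤ r
≤⇒ceil√-half-≤ x r x≤2r² = ceil√-least ((ℤ.+ x) ℚᵘ./ 2) r (*≤* (subst₂ ℤ._≤_
  (ℤ.pos-* x 1) (ℤ.pos-* (r * r) 2) (ℤ.+≤+ (begin
    x * 1     ≡⟨ *-identityʳ x ⟩
    x         ≤⟨ x≤2r² ⟩
    2 * r ^ 2 ≡⟨ lemma r ⟩
    r * r * 2 ∎))))
  where
  open ≤-Reasoning
  lemma : ∀ r → 2 * (r * (r * 1)) ≡ r * r * 2
  lemma = solve-∀

-- As `f` divides 2, the quotient `Q` of `2 * r ^ 2` by `f` is exact. Then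
-- `2n² = 2r²s² = Q f s² = Q d`, so `Q` is also the exact quotient of `2n²` by `d`.
closed-forms : ∀ {d} (A : Admissible d) r → Triple.ClosedForms A r
closed-forms {d} A r = record
  { d≡fs²  = d≡fs²
  ; d∣2n²  = divides Q 2n²≡Qd
  ; f∣2r²  = f∣2r²
  ; a-form = a≡
  ; b-form = b≡
  ; c-form = cong₂ _+_ b≡ d≡fs²
  }
  where
  open ≡-Reasoning
  instance
    d≢0 : NonZero d
    d≢0 = admissible⇒nonZero A
    f≢0 : NonZero (f A)
    f≢0 = f-nonZero A
  d≡fs² = admissible-≡fs² A
  f∣2r² = ∣m⇒∣m*n (r ^ 2) (shape-∣2 (admissible-shape A))
  Q = (2 * r ^ 2) / f A
  2n = 2 * (s A * r)
  2n²≡Qd : 2 * (s A * r) ^ 2 ≡ Q * d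
  2n²≡Qd = begin
    2 * (s A * r) ^ 2     ≡⟨ expand (s A) r ⟩
    2 * r ^ 2 * s A ^ 2   ≡⟨ cong (_* s A ^ 2) (m*[n/m]≡n f∣2r²) ⟨
    f A * Q * s A ^ 2     ≡⟨ cong (_* s A ^ 2) (*-comm (f A) Q) ⟩
    Q * f A * s A ^ 2     ≡⟨ *-assoc Q (f A) (s A ^ 2) ⟩
    Q * (f A * s A ^ 2)   ≡⟨ cong (Q *_) d≡fs² ⟨
    Q * d                 ∎
    where
    expand : ∀ u r → 2 * (u * r * (u * r * 1)) ≡ 2 * (r * (r * 1)) * (u * (u * 1))
    expand = solve-∀
  a≡ : 2n + d ≡ 2 * s A * r + f A * s A ^ 2
  a≡ = cong₂ _+_ (sym (*-assoc 2 (s A) r)) d≡fs²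
  b≡ : 2n + (2 * (s A * r) ^ 2) / d ≡ 2 * s A * r + Q
  b≡ = cong₂ _+_ (sym (*-assoc 2 (s A) r))
    (trans (cong (_/ d) 2n²≡Qd) (m*n/n≡m Q d))

-- From parameters to triples.

2∣^2⇒2∣ : 2 ∣ n ^ 2 → 2 ∣ n
2∣^2⇒2∣ = prime∣^⇒prime∣ prime[2] 2

shape⇒triple : ∀ {g u r q} → .{{NonZero u}} → Shape g u → g * q ≡ 2 * r ^ 2 →
  g * (g * u ^ 2) ≤ 2 * r ^ 2 → (∀ p → Prime p → p ∣ g * u ^ 2 → ¬ p ∣ r) →
  IDPT (2 * u * r + g * u ^ 2) (2 * u * r + q) (2 * u * r + q + g * u ^ 2)
shape⇒triple {g} {u} {r} {q} sh gq≡2r² gd≤2r² p∤r = record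
  { dpt = record
    { a-positive  = <-≤-trans d>0 (m≤n+m d (2 * u * r))
    ; b-positive  = ≤-<-trans z≤n a<b
    ; c-positive  = <-≤-trans d>0 (m≤n+m d b)
    ; a<b         = a<b
    ; b<c         = m<m+n b d>0
    ; pythagorean = pythagoras
    }
  ; irreducible = no-prime-divisor⇒≡1 no-prime
  }
  where
  d = g * u ^ 2
  a = 2 * u * r + d
  b = 2 * u * r + q
  instance
    g≢0 : NonZero g
    g≢0 = ≢-nonZero λ { refl → case 0∣⇒≡0 (shape-∣2 sh) of λ () }
  d>0 : 0 < d
  d>0 = >-nonZero⁻¹ d {{m*n≢0 g (u ^ 2) {{g≢0}} {{m^n≢0 u 2}}}}
  -- Equality would give `u² = 2r²` with `u` odd in the first case, and `2u² = r²` in the second,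
  -- where 2 would divide both `d` and `r`.
  d≢q : Shape g u → d ≢ q
  d≢q (odd-square 2∤u) d≡q = 2∤u (2∣^2⇒2∣ (divides (r ^ 2) (begin
    u ^ 2       ≡⟨ *-identityˡ (u ^ 2) ⟨
    1 * u ^ 2   ≡⟨ d≡q ⟩
    q           ≡⟨ *-identityˡ q ⟨
    1 * q       ≡⟨ gq≡2r² ⟩
    2 * r ^ 2   ≡⟨ *-comm 2 (r ^ 2) ⟩
    r ^ 2 * 2   ∎)))
    where open ≡-Reasoning
  d≢q double-square d≡q = p∤r 2 prime[2] (m∣m*n (u ^ 2))
    (2∣^2⇒2∣ (subst (2 ∣_) (trans d≡q (*-cancelˡ-≡ _ _ 2 gq≡2r²)) (m∣m*n (u ^ 2))))
  a<b : a < b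
  a<b = +-monoʳ-< (2 * u * r)
    (≤∧≢⇒< (*-cancelˡ-≤ g (≤-trans gd≤2r² (≤-reflexive (sym gq≡2r²)))) (d≢q sh))
  pythagoras : a ^ 2 + b ^ 2 ≡ (b + d) ^ 2
  -- The term `4u²r²` of `a²` is `2r² * 2u²`; replacing `2r²` by `g q` turns it into `2dq`, the one
  -- term of `c² - b²` that involves `q`.
  pythagoras = begin
    a ^ 2 + b ^ 2                           ≡⟨ lhs u r g b ⟩
    2 * r ^ 2 * (2 * u ^ 2) + rest          ≡⟨ cong (λ x → x * (2 * u ^ 2) + rest) gq≡2r² ⟨
    g * q * (2 * u ^ 2) + rest              ≡⟨ rhs u r g q ⟩
    (b + d) ^ 2                             ∎
    where
    open ≡-Reasoning
    rest = 4 * u * r * d + d ^ 2 + b ^ 2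
    lhs : ∀ u r g b →
      (2 * u * r + g * (u * (u * 1))) * ((2 * u * r + g * (u * (u * 1))) * 1) + b * (b * 1) ≡
      2 * (r * (r * 1)) * (2 * (u * (u * 1))) + (4 * u * r * (g * (u * (u * 1)))
        + g * (u * (u * 1)) * (g * (u * (u * 1)) * 1) + b * (b * 1))
    lhs = solve-∀
    rhs : ∀ u r g q →
      g * q * (2 * (u * (u * 1))) + (4 * u * r * (g * (u * (u * 1)))
        + g * (u * (u * 1)) * (g * (u * (u * 1)) * 1) + (2 * u * r + q) * ((2 * u * r + q) * 1)) ≡
      (2 * u * r + q + g * (u * (u * 1))) * ((2 * u * r + q + g * (u * (u * 1))) * 1)
    rhs = solve-∀
  -- Here `q` is `2r²` or `r²`, so `p` divides `r` unless `p = 2` in the first case, where `d = u²`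
  -- is odd.
  p∤q : Shape g u → ∀ p → Prime p → p ∣ d → ¬ p ∣ q
  p∤q (odd-square 2∤u) p p-prime p∣d p∣q
    with euclidsLemma 2 (r ^ 2) p-prime (subst (p ∣_) gq≡2r² (∣n⇒∣m*n 1 p∣q))
  ... | inj₁ p∣2 with refl ← prime∣prime⇒≡ p-prime prime[2] p∣2 =
    2∤u (2∣^2⇒2∣ (subst (2 ∣_) (*-identityˡ (u ^ 2)) p∣d))
  ... | inj₂ p∣r² = p∤r p p-prime p∣d (prime∣^⇒prime∣ p-prime 2 p∣r²)
  p∤q double-square p p-prime p∣d p∣q = p∤r p p-prime p∣d
    (prime∣^⇒prime∣ p-prime 2 (subst (p ∣_) (*-cancelˡ-≡ _ _ 2 gq≡2r²) p∣q))
  no-prime : ∀ p → Prime p → ¬ p ∣ gcd (gcd a b) (b + d)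
  -- Successive differences: `d = c - b`, `2ur = a - d`, `q = b - 2ur`.
  no-prime p p-prime p∣gcd = p∤q sh p p-prime p∣d (∣m+n∣m⇒∣n p∣b p∣2ur)
    where
    p∣gcd′ = ∣-trans p∣gcd (gcd[m,n]∣m (gcd a b) (b + d))
    p∣b = ∣-trans p∣gcd′ (gcd[m,n]∣n a b)
    p∣d = ∣m+n∣m⇒∣n (∣-trans p∣gcd (gcd[m,n]∣n (gcd a b) (b + d))) p∣b
    p∣2ur : p ∣ 2 * u * r
    p∣2ur = ∣m+n∣m⇒∣n (subst (p ∣_) (+-comm (2 * u * r) d) (∣-trans p∣gcd′ (gcd[m,n]∣m a b))) p∣d

conditions⇒triple : ∀ {d} (A : Admissible d) r → Conditions A r →
  IDPT (Triple.a A r) (Triple.b A r) (Triple.c A r)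
conditions⇒triple {d} A r cond = subst₂ (λ a (b , c) → IDPT a b c) (sym a-form)
  (sym (cong₂ _,_ b-form c-form))
  (shape⇒triple (admissible-shape A) (m*[n/m]≡n {{f-nonZero A}} f∣2r²)
    (ceil√-half-≤⇒ _ r (subst (λ x → ⌈√ (ℤ.+ (f A * x)) ℚᵘ./ 2 ⌉ ≤ r) d≡fs² bound))
    λ p p-prime p∣fs² → let p∣d = subst (p ∣_) (sym d≡fs²) p∣fs² in
      -- Having a prime divisor already forces `1 < d`.
      no-common-prime (<-≤-trans (prime⇒≥2 p-prime) (∣⇒≤ p∣d)) p p-prime p∣d)
  where
  open Conditions cond
  open Triple.ClosedForms (closed-forms A r)
  instance
    d≢0 : NonZero d
    d≢0 = admissible⇒nonZero A
    s≢0 : NonZero (s A)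
    s≢0 = ≢-nonZero λ s≡0 → ≢-nonZero⁻¹ d
      (trans d≡fs² (trans (cong (λ x → f A * x ^ 2) s≡0) (*-zeroʳ (f A))))

-- From triples to parameters.

no-common-prime-divisor : ∀ {a b c p} → IDPT a b c → Prime p → p ∣ a → p ∣ b → ¬ p ∣ c
no-common-prime-divisor T p-prime p∣a p∣b p∣c = ¬prime[1] (subst Prime
  (∣1⇒≡1 (subst (_ ∣_) (IDPT.irreducible T) (gcd-greatest (gcd-greatest p∣a p∣b) p∣c))) p-prime)

^2-gap : ∀ m n → m ^ 2 < n ^ 2 → ∃[ v ] n ≡ m + v
^2-gap m n m²<n² with ≤-total m n
... | inj₁ m≤n = n ∸ m , sym (m+[n∸m]≡n m≤n)
... | inj₂ n≤m = contradiction m²<n² (≤⇒≯ (^-monoˡ-≤ 2 n≤m))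

-- What a triple yields before any primes are chosen. The field `q` stands for `2r²/f`, specified by
-- a product to avoid division.
record Parameters (a b d : ℕ) : Set where
  field
    {g u r q} : ℕ
    u≢0       : NonZero u
    shape     : Shape g u
    gq≡2r²    : g * q ≡ 2 * r ^ 2
    d≡        : d ≡ g * u ^ 2
    a≡        : a ≡ 2 * u * r + g * u ^ 2
    b≡        : b ≡ 2 * u * r + q

module _ {a b d : ℕ} (T : IDPT a b (b + d)) where

  open IDPT T
  open DPT dpt

  -- With `c = b + d`, the factor `d + 2 * b` is `c + b`.
  a²≡ : a ^ 2 ≡ d * (d + 2 * b)
  a²≡ = +-cancelʳ-≡ (b ^ 2) _ _ (trans pythagorean (lemma b d))
    where
    lemma : ∀ b d → (b + d) * ((b + d) * 1) ≡ d * (d + 2 * b) + b * (b * 1)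
    lemma = solve-∀

  -- A prime dividing `d` divides `a²`, hence `a`; dividing `b` as well, it would divide `c`.
  p∣d⇒p∤b : ∀ p → Prime p → p ∣ d → ¬ p ∣ b
  p∣d⇒p∤b p p-prime p∣d p∣b = no-common-prime-divisor T p-prime
    (prime∣^⇒prime∣ p-prime 2 (subst (p ∣_) (sym a²≡) (∣m⇒∣m*n (d + 2 * b) p∣d)))
    p∣b (∣m∣n⇒∣m+n p∣b p∣d)

  d≢0 : NonZero d
  d≢0 = ≢-nonZero λ { refl → <-irrefl (sym (+-identityʳ b)) b<c }

  -- A common prime divides `2 * b`; it is not 2 because `d` is odd, so it divides `b`.
  odd⇒coprime : ¬ 2 ∣ d → Coprime d (d + 2 * b)
  odd⇒coprime 2∤d = no-common-prime⇒coprime λ p p-prime p∣d p∣e →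
    case euclidsLemma 2 b p-prime (∣m+n∣m⇒∣n p∣e p∣d) of λ
      { (inj₁ p∣2) → 2∤d (subst (_∣ d) (prime∣prime⇒≡ p-prime prime[2] p∣2) p∣d)
      ; (inj₂ p∣b) → p∣d⇒p∤b p p-prime p∣d p∣b }

  2b≡ : ∀ g v → d ≡ g ^ 2 → d + 2 * b ≡ (g + v) ^ 2 → 2 * b ≡ 2 * (g * v) + v ^ 2
  2b≡ g v d≡g² e≡ = +-cancelˡ-≡ d _ _ (trans e≡ (trans (lemma g v) (cong (_+ _) (sym d≡g²))))
    where
    lemma : ∀ g v → (g + v) * ((g + v) * 1) ≡ g * (g * 1) + (2 * (g * v) + v * (v * 1))
    lemma = solve-∀

  odd-parameters : ¬ 2 ∣ d → ∀ g w → d ≡ g ^ 2 → d + 2 * b ≡ (g + w * 2) ^ 2 →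
                   a ≡ g * (g + w * 2) → Parameters a b d
  odd-parameters 2∤d g w d≡g² e≡ a≡ = record
    { g      = 1
    ; u      = g
    ; r      = w
    ; q      = 2 * w ^ 2
    ; u≢0    = ≢-nonZero λ { refl → ≢-nonZero⁻¹ d {{d≢0}} d≡g² }
    ; shape  = odd-square λ 2∣g → 2∤d (subst (2 ∣_) (sym d≡g²) (∣m⇒∣m*n (g * 1) 2∣g))
    ; gq≡2r² = *-identityˡ (2 * w ^ 2)
    ; d≡     = trans d≡g² (sym (*-identityˡ (g ^ 2)))
    ; a≡     = trans a≡ (a-expand g w)
    ; b≡     = *-cancelˡ-≡ _ _ 2 (trans (2b≡ g (w * 2) d≡g² e≡) (b-expand g w))
    }
    where
    a-expand : ∀ g w → g * (g + w * 2) ≡ 2 * g * w + 1 * (g * (g * 1))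
    a-expand = solve-∀
    b-expand : ∀ g w → 2 * (g * (w * 2)) + w * 2 * (w * 2 * 1) ≡ 2 * (2 * g * w + 2 * (w * (w * 1)))
    b-expand = solve-∀

  odd-difference : ¬ 2 ∣ d → Parameters a b d
  odd-difference 2∤d =
    case coprime-square {{d≢0}} (odd⇒coprime 2∤d) (sym a²≡) of λ
      { (g , t , d≡g² , e≡t² , a≡gt) →
    case ^2-gap g t (subst₂ _<_ d≡g² e≡t² (m<m+n d (*-monoʳ-< 2 b-positive))) of λ
      { (v , refl) →
    -- The gap `v` is even since `v² = 2b - 2gv`; its half `w` becomes `r`.
    case 2∣^2⇒2∣ {v} (∣m+n∣m⇒∣n (subst (2 ∣_) (2b≡ g v d≡g² e≡t²) (m∣m*n b)) (m∣m*n (g * v))) of λ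
      { (divides w refl) → odd-parameters 2∤d g w d≡g² e≡t² a≡gt }}}

  -- Here `x` and `x + b` are the halves of `c - b` and `c + b`. They differ by `b`, which shares no
  -- prime with `d`.
  module Half {x : ℕ} (d≡2x : d ≡ x * 2) where

    x∣d : x ∣ d
    x∣d = subst (x ∣_) (sym d≡2x) (m∣m*n 2)

    x≢0 : NonZero x
    x≢0 = ≢-nonZero λ { refl → ≢-nonZero⁻¹ d {{d≢0}} d≡2x }

    x⊥y : Coprime x (x + b)
    x⊥y = no-common-prime⇒coprime λ p p-prime p∣x p∣y →
      p∣d⇒p∤b p p-prime (∣-trans p∣x x∣d) (∣m+n∣m⇒∣n p∣y p∣x)

    xy≡z² : ∀ z → a ≡ z * 2 → x * (x + b) ≡ z ^ 2
    xy≡z² z a≡2z = *-cancelˡ-≡ _ _ 4 (begin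
      4 * (x * (x + b))         ≡⟨ lhs x b ⟩
      x * 2 * (x * 2 + 2 * b)   ≡⟨ cong (λ d → d * (d + 2 * b)) d≡2x ⟨
      d * (d + 2 * b)           ≡⟨ a²≡ ⟨
      a ^ 2                     ≡⟨ cong (_^ 2) a≡2z ⟩
      (z * 2) ^ 2               ≡⟨ rhs z ⟩
      4 * z ^ 2                 ∎)
      where
      open ≡-Reasoning
      lhs : ∀ x b → 4 * (x * (x + b)) ≡ x * 2 * (x * 2 + 2 * b)
      lhs = solve-∀
      rhs : ∀ z → z * 2 * (z * 2 * 1) ≡ 4 * (z * (z * 1))
      rhs = solve-∀

  -- Unlike in the odd case, the gap `v` between the two roots is itself `r`.
  even-parameters : ∀ x → d ≡ x * 2 → ∀ g v → x ≡ g ^ 2 → x + b ≡ (g + v) ^ 2 →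
                    a ≡ g * (g + v) * 2 → Parameters a b d
  even-parameters x d≡2x g v x≡g² y≡t² a≡ = record
    { g      = 2
    ; u      = g
    ; r      = v
    ; q      = v ^ 2
    ; u≢0    = ≢-nonZero λ { refl → ≢-nonZero⁻¹ x {{Half.x≢0 {x} d≡2x}} x≡g² }
    ; shape  = double-square
    ; gq≡2r² = refl
    ; d≡     = trans d≡2x (trans (*-comm x 2) (cong (2 *_) x≡g²))
    ; a≡     = trans a≡ (a-expand g v)
    ; b≡     = +-cancelˡ-≡ x _ _ (trans y≡t² (trans (b-expand g v) (cong (_+ _) (sym x≡g²))))
    }
    where
    a-expand : ∀ g v → g * (g + v) * 2 ≡ 2 * g * v + 2 * (g * (g * 1))
    a-expand = solve-∀
    b-expand : ∀ g v → (g + v) * ((g + v) * 1) ≡ g * (g * 1) + (2 * g * v + v * (v * 1))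
    b-expand = solve-∀

  even-difference : 2 ∣ d → Parameters a b d
  even-difference 2∣d@(divides x d≡2x) =
    case 2∣^2⇒2∣ {a} (subst (2 ∣_) (sym a²≡) (∣m⇒∣m*n (d + 2 * b) 2∣d)) of λ
      { (divides z a≡2z) →
    case coprime-square {r = z} {{x≢0}} x⊥y (xy≡z² z a≡2z) of λ
      { (g , t , x≡g² , y≡t² , z≡gt) →
    case ^2-gap g t (subst₂ _<_ x≡g² y≡t² (m<m+n x b-positive)) of λ
      { (v , refl) →
    even-parameters x d≡2x g v x≡g² y≡t² (trans a≡2z (cong (_* 2) z≡gt)) }}}
    where open Half {x} d≡2x

triple⇒parameters : ∀ {a b d} → IDPT a b (b + d) → Parameters a b d
triple⇒parameters {d = d} T with 2 ∣? d
... | yes 2∣d = even-difference T 2∣d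
... | no  2∤d = odd-difference T 2∤d

-- Conditions on the parameters, and assembly.

shape⇒r∣q : ∀ {g u r q} → Shape g u → g * q ≡ 2 * r ^ 2 → r ∣ q
shape⇒r∣q {r = r} {q} (odd-square _) q≡2r² =
  subst (r ∣_) (trans (sym q≡2r²) (*-identityˡ q)) (∣n⇒∣m*n 2 (m∣m*n (r * 1)))
shape⇒r∣q {r = r} double-square 2q≡2r² =
  subst (r ∣_) (sym (*-cancelˡ-≡ _ _ 2 2q≡2r²)) (m∣m*n (r * 1))

-- Cancelling `2sr` in `a < b` gives `d < q`, whence the bound `f d ≤ f q = 2r²`. Since `r` divides
-- `q`, `r = 0` would force `q = 0`, and a prime dividing `d` and `r` would divide `a`, `b` and `c`.
triple⇒arises : ∀ {a b d r q} (A : Admissible d) → IDPT a b (b + d) → f A * q ≡ 2 * r ^ 2 →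
  a ≡ 2 * s A * r + f A * s A ^ 2 → b ≡ 2 * s A * r + q →
  Conditions A r × a ≡ Triple.a A r × b ≡ Triple.b A r × b + d ≡ Triple.c A r
triple⇒arises {a} {b} {d} {r} {q} A T fq≡2r² a≡ b≡ =
  conditions , trans a≡ (sym a-form) , b≡′ , cong (_+ d) b≡′
  where
  open Triple.ClosedForms (closed-forms A r)
  instance
    f≢0 : NonZero (f A)
    f≢0 = f-nonZero A
  b≡′ : b ≡ Triple.b A r
  b≡′ = trans b≡ (trans
    (cong (2 * s A * r +_) (*-cancelˡ-≡ _ _ (f A) (trans fq≡2r² (sym (m*[n/m]≡n f∣2r²)))))
    (sym b-form))
  a≡′ : a ≡ 2 * s A * r + d
  a≡′ = trans a≡ (cong (2 * s A * r +_) (sym d≡fs²))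
  r∣q : r ∣ q
  r∣q = shape⇒r∣q (admissible-shape A) fq≡2r²
  d<q : d < q
  d<q = +-cancelˡ-< (2 * s A * r) _ _ (subst₂ _<_ a≡′ b≡ (DPT.a<b (IDPT.dpt T)))
  conditions : Conditions A r
  conditions = record
    { r-positive      = n≢0⇒n>0 λ { refl → n≮0 (subst (d <_) (0∣⇒≡0 r∣q) d<q) }
    ; bound           = ≤⇒ceil√-half-≤ (f A * d) r
        (≤-trans (*-monoʳ-≤ (f A) (<⇒≤ d<q)) (≤-reflexive fq≡2r²))
    ; no-common-prime = λ _ p p-prime p∣d p∣r →
        let p∣2sr = ∣n⇒∣m*n (2 * s A) p∣r
            p∣b   = subst (p ∣_) (sym b≡) (∣m∣n⇒∣m+n p∣2sr (∣-trans p∣r r∣q))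
        in no-common-prime-divisor T p-prime
             (subst (p ∣_) (sym a≡′) (∣m∣n⇒∣m+n p∣2sr p∣d)) p∣b (∣m∣n⇒∣m+n p∣b p∣d)
    }

parameters⇒arises : ∀ {a b d} → IDPT a b (b + d) → Parameters a b d →
  Σ[ A ∈ Admissible d ] ∃[ r ]
    Conditions A r × a ≡ Triple.a A r × b ≡ Triple.b A r × b + d ≡ Triple.c A r
parameters⇒arises T record
  { u≢0 = u≢0 ; shape = sh ; gq≡2r² = gq≡2r² ; d≡ = refl ; a≡ = a≡ ; b≡ = b≡ }
  with shape-admissible {{u≢0}} sh
... | A , f≡g , s≡u = A , _ , triple⇒arises A T
  (trans (cong (_* _) f≡g) gq≡2r²)
  (trans a≡ (sym (cong₂ (λ f s → 2 * s * _ + f * s ^ 2) f≡g s≡u)))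
  (trans b≡ (sym (cong (λ s → 2 * s * _ + _) s≡u)))

theorem5 : (∀ (d : ℕ) (A : Admissible d) (r : ℕ) → Conditions A r →
    IDPT (Triple.a A r) (Triple.b A r) (Triple.c A r) × Triple.ClosedForms A r)
    ×
    (∀ (a b c : ℕ) → IDPT a b c →
    ∃[ d ] Σ[ A ∈ Admissible d ] ∃[ r ]
    (d ≡ c ∸ b × Conditions A r ×
    a ≡ Triple.a A r × b ≡ Triple.b A r × c ≡ Triple.c A r))
theorem5 =
  (λ _ A r cond → conditions⇒triple A r cond , closed-forms A r) , converse
  where
  converse : ∀ a b c → IDPT a b c →
    ∃[ d ] Σ[ A ∈ Admissible d ] ∃[ r ]
    (d ≡ c ∸ b × Conditions A r ×
    a ≡ Triple.a A r × b ≡ Triple.b A r × c ≡ Triple.c A r)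
  converse a b c T
    -- Matching on `refl` replaces `c` by `b + d`, so truncated subtraction appears only in the
    -- final equation for `d`.
    with d , refl ← m≤n⇒∃[o]m+o≡n (<⇒≤ (DPT.b<c (IDPT.dpt T)))
    with A , r , cond , a≡ , b≡ , c≡ ← parameters⇒arises T (triple⇒parameters T) =
    d , A , r , sym (m+n∸m≡n b d) , cond , a≡ , b≡ , c≡
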